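{- Let $n\ge 1$ and $q$ be integers with $q \ge \sqrt{2n}$, and let $\mathcal{H}$ be a $q$-uniform linear hypergraph on vertex set $[n]$. Then $e(\mathcal{H}) < q$. Further, if $q\le n$ and $\mathcal{H}$ is maximal, then $e(\mathcal{H}) = \Theta\left(\frac{n}{q}\right)$; that is, there are absolute constants $c,C>0$ (independent of $n$, $q$ and $\mathcal{H}$) such that $c\,\frac{n}{q}\le e(\mathcal{H})\le C\,\frac{n}{q}$.
   Context: $[n]=\{1,\dots,n\}$. A $q$-uniform hypergraph on $[n]$ is a set of $q$-element subsets of $[n]$, called edges; $e(\mathcal{H})$ is the number of edges. A hypergraph is linear if any two distinct edges $A,B$ satisfy $|A\cap B|\le 1$. A $q$-uniform linear hypergraph $\mathcal{H}$ on $[n]$ is maximal if there is no $q$-subset $e\notin\mathcal{H}$ of $[n]$ such that $\mathcal{H}\cup\{e\}$ is linear. -}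

module Defs where

open import Data.Nat using (ℕ; zero; suc; _≤_; _*_; NonZero; z≤n; s≤s)
open import Data.Integer using (+_)
open import Data.Rational using (ℚ; _/_)
open import Data.Fin.Subset using (Subset; ∣_∣; _∩_)
open import Data.List using (List; length; _∷_)
open import Data.List.Membership.Propositional using (_∈_; _∉_)
open import Data.List.Relation.Unary.All using (All; _∷_)
open import Data.List.Relation.Unary.All.Properties using (¬Any⇒All¬)
open import Data.List.Relation.Unary.AllPairs using (_∷_)
open import Data.List.Relation.Unary.Unique.Propositional using (Unique)
open import Data.Product using (Σ-syntax)
open import Relation.Nullary using (¬_)
open import Relation.Binary.PropositionalEquality using (_≡_; _≢_)

-- The vertex set is Fin n, standing for {1, …, n}.  The set of edges is a
-- duplicate-free list, so that its length is its cardinality.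
record Hypergraph (q n : ℕ) : Set where
  field
    edges    : List (Subset n)
    distinct : Unique edges
    uniform  : All (λ A → ∣ A ∣ ≡ q) edges

open Hypergraph public

private
  variable
    q n : ℕ

e : Hypergraph q n → ℕ
e H = length (edges H)

Linear : Hypergraph q n → Set
Linear H = ∀ {A B} → A ∈ edges H → B ∈ edges H → A ≢ B → ∣ A ∩ B ∣ ≤ 1

insert : (H : Hypergraph q n) (A : Subset n) → ∣ A ∣ ≡ q → A ∉ edges H → Hypergraph q n
insert H A ∣A∣≡q A∉H = record
  { edges    = A ∷ edges H
  ; distinct = ¬Any⇒All¬ (edges H) A∉H ∷ distinct H
  ; uniform  = ∣A∣≡q ∷ uniform H
  }

Maximal : Hypergraph q n → Set
Maximal {q} {n} H =
  ¬ (Σ[ A ∈ Subset n ] Σ[ ∣A∣≡q ∈ ∣ A ∣ ≡ q ] Σ[ A∉H ∈ A ∉ edges H ]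
      Linear (insert H A ∣A∣≡q A∉H))

-- Both sides of q ≥ √(2n) are squared; an integer q satisfying it is never
-- negative, so q is taken in ℕ.
_≥√2·_ : ℕ → ℕ → Set
q ≥√2· n = 2 * n ≤ q * q

≥√2·⇒nonZero : 1 ≤ n → q ≥√2· n → NonZero q
≥√2·⇒nonZero {q = suc _} _       _  = _
≥√2·⇒nonZero {q = zero}  (s≤s _) ()

fromℕ : ℕ → ℚ
fromℕ m = + m / 1

{-# OPTIONS --safe #-}
module Submission where

-- If H is maximal, fewer than q vertices are uncovered, since q of them would form a
-- new edge; hence q ≤ n < (e(H) + 1) q, so e(H) ≥ 1 and e(H) ≥ n / 2q.  In the other
-- direction, the i-th edge contributes at least q - (i - 1) new vertices, so m edges
-- cover at least m q - m (m - 1) / 2: q edges would cover more than q² / 2 ≥ n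
-- vertices, and for m = e(H) < q the bound is at least m q / 2.

open import Data.Nat using (ℕ; _≤_; _<_)
open import Data.Integer using (+_)
open import Data.Rational as ℚ using (ℚ; 0ℚ)
open import Data.Product using (_×_; ∃-syntax)
open import Defs

open import Data.Bool using (true; false)
open import Data.Fin.Subset
  using (Subset; ∣_∣; _∩_; _∪_; ⋃; ∁; ⊥; Empty; _⊆_; inside; outside)
open import Data.Fin.Subset.Properties
  using ( ∩-distribˡ-∪; ∩-zeroʳ; ∩-comm; ∣⊥∣≡0; ∣p∣≤n; ⊥⊆; out⊆; in⊆in; Empty-unique
        ; p⊆p∪q; q⊆p∪q; x∈p∩q⁻; x∈∁p⇒x∉p; ∣∁p∣≡n∸∣p∣; ∩-idem )
import Data.Integer as ℤ
import Data.Integer.Properties as ℤ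
open import Data.List using (List; []; _∷_; length; take)
open import Data.List.Membership.Propositional using (_∈_; _∉_)
open import Data.List.Properties using (length-take)
open import Data.List.Relation.Unary.All as All using (All; []; _∷_)
import Data.List.Relation.Unary.All.Properties as All
open import Data.List.Relation.Unary.AllPairs using (AllPairs; []; _∷_)
import Data.List.Relation.Unary.AllPairs.Properties as AllPairs
open import Data.List.Relation.Unary.Any using (here; there)
open import Data.List.Relation.Unary.Unique.Propositional using (Unique)
open import Data.Nat using (zero; suc; _+_; _*_; _∸_; NonZero; z≤n; s≤s; >-nonZero⁻¹; ≢-nonZero⁻¹)
open import Data.Nat.Properties
open import Data.Nat.Tactic.RingSolver using (solve-∀)
open import Data.Product using (_,_)
import Data.Rational.Properties as ℚ
import Data.Rational.Unnormalised as ℚᵘ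
import Data.Rational.Unnormalised.Properties as ℚᵘ
open import Data.Vec using ([]; _∷_)
open import Function using (_∘_)
open import Relation.Nullary using (contradiction)
open import Relation.Binary.PropositionalEquality
  using (_≡_; _≢_; refl; sym; trans; cong; subst; subst₂)

private
  variable
    q n : ℕ

-- Cardinalities of unions of edges.

m+m≡2*m : ∀ m → m + m ≡ 2 * m
m+m≡2*m = solve-∀

∣p∪q∣+∣p∩q∣≡∣p∣+∣q∣ : (p q : Subset n) → ∣ p ∪ q ∣ + ∣ p ∩ q ∣ ≡ ∣ p ∣ + ∣ q ∣
∣p∪q∣+∣p∩q∣≡∣p∣+∣q∣ []          []          = refl
∣p∪q∣+∣p∩q∣≡∣p∣+∣q∣ (false ∷ p) (false ∷ q) = ∣p∪q∣+∣p∩q∣≡∣p∣+∣q∣ p q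
∣p∪q∣+∣p∩q∣≡∣p∣+∣q∣ (false ∷ p) (true ∷ q)  =
  trans (cong suc (∣p∪q∣+∣p∩q∣≡∣p∣+∣q∣ p q)) (sym (+-suc ∣ p ∣ ∣ q ∣))
∣p∪q∣+∣p∩q∣≡∣p∣+∣q∣ (true ∷ p)  (false ∷ q) = cong suc (∣p∪q∣+∣p∩q∣≡∣p∣+∣q∣ p q)
∣p∪q∣+∣p∩q∣≡∣p∣+∣q∣ (true ∷ p)  (true ∷ q)  = cong suc
  (trans (+-suc ∣ p ∪ q ∣ ∣ p ∩ q ∣)
    (trans (cong suc (∣p∪q∣+∣p∩q∣≡∣p∣+∣q∣ p q)) (sym (+-suc ∣ p ∣ ∣ q ∣))))

∣p∪q∣≤∣p∣+∣q∣ : (p q : Subset n) → ∣ p ∪ q ∣ ≤ ∣ p ∣ + ∣ q ∣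
∣p∪q∣≤∣p∣+∣q∣ p q =
  ≤-trans (m≤m+n ∣ p ∪ q ∣ ∣ p ∩ q ∣) (≤-reflexive (∣p∪q∣+∣p∩q∣≡∣p∣+∣q∣ p q))

-- Keeps the first `k` elements of `p`. It carves a candidate edge out of the uncovered vertices.
⊆-ofSize : ∀ k (p : Subset n) → k ≤ ∣ p ∣ → ∃[ r ] r ⊆ p × ∣ r ∣ ≡ k
⊆-ofSize {n} zero p           _         = ⊥ , ⊥⊆ , ∣⊥∣≡0 n
⊆-ofSize (suc k)  (false ∷ p) k≤∣p∣     with ⊆-ofSize (suc k) p k≤∣p∣
... | r , r⊆p , ∣r∣≡k = outside ∷ r , out⊆ r⊆p , ∣r∣≡k
⊆-ofSize (suc k)  (true ∷ p)  (s≤s k≤∣p∣) with ⊆-ofSize k p k≤∣p∣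
... | r , r⊆p , ∣r∣≡k = inside ∷ r , in⊆in r⊆p , cong suc ∣r∣≡k

∈⇒⊆⋃ : ∀ {A : Subset n} {As} → A ∈ As → A ⊆ ⋃ As
∈⇒⊆⋃ {As = _ ∷ As} (here refl) = p⊆p∪q (⋃ As)
∈⇒⊆⋃ {As = B ∷ As} (there A∈As) = q⊆p∪q B (⋃ As) ∘ ∈⇒⊆⋃ A∈As

∣⋃∣≤length*q : (As : List (Subset n)) → All (λ A → ∣ A ∣ ≡ q) As → ∣ ⋃ As ∣ ≤ length As * q
∣⋃∣≤length*q {n} []       []           = ≤-reflexive (∣⊥∣≡0 n)
∣⋃∣≤length*q     (A ∷ As) (refl ∷ ∣As∣) =
  ≤-trans (∣p∪q∣≤∣p∣+∣q∣ A (⋃ As)) (+-monoʳ-≤ ∣ A ∣ (∣⋃∣≤length*q As ∣As∣))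

-- Each `B` accounts for at most one vertex of the intersection. This bounds what an edge loses to
-- the edges already in the union.
∣∩⋃∣≤length : (A : Subset n) (Bs : List (Subset n)) →
  All (λ B → ∣ A ∩ B ∣ ≤ 1) Bs → ∣ A ∩ ⋃ Bs ∣ ≤ length Bs
∣∩⋃∣≤length {n} A [] [] = ≤-reflexive (trans (cong ∣_∣ (∩-zeroʳ A)) (∣⊥∣≡0 n))
∣∩⋃∣≤length A (B ∷ Bs) (∣A∩B∣≤1 ∷ rest) = begin
  ∣ A ∩ (B ∪ ⋃ Bs) ∣          ≡⟨ cong ∣_∣ (∩-distribˡ-∪ A B (⋃ Bs)) ⟩
  ∣ (A ∩ B) ∪ (A ∩ ⋃ Bs) ∣    ≤⟨ ∣p∪q∣≤∣p∣+∣q∣ (A ∩ B) (A ∩ ⋃ Bs) ⟩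
  ∣ A ∩ B ∣ + ∣ A ∩ ⋃ Bs ∣    ≤⟨ +-mono-≤ ∣A∩B∣≤1 (∣∩⋃∣≤length A Bs rest) ⟩
  suc (length Bs)             ∎
  where open ≤-Reasoning

-- The bound m q - m (m - 1) / 2, doubled and rearranged to avoid subtraction.
2qm+m≤2∣⋃∣+m² : (As : List (Subset n)) → All (λ A → ∣ A ∣ ≡ q) As →
  AllPairs (λ A B → ∣ A ∩ B ∣ ≤ 1) As →
  let m = length As in 2 * (q * m) + m ≤ 2 * ∣ ⋃ As ∣ + m * m
2qm+m≤2∣⋃∣+m² {q = q} [] [] [] rewrite *-zeroʳ q = z≤n
2qm+m≤2∣⋃∣+m² {q = q} (A ∷ As) (∣A∣≡q ∷ ∣As∣) (A∩ ∷ As∩) = begin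
  2 * (q * suc m) + suc m                ≡⟨ split q m ⟩
  2 * q + suc (2 * (q * m) + m)
    ≤⟨ +-monoʳ-≤ (2 * q) (s≤s (2qm+m≤2∣⋃∣+m² As ∣As∣ As∩)) ⟩
  2 * q + suc (2 * ∣ U ∣ + m * m)        ≡⟨ regroup q ∣ U ∣ m ⟩
  2 * (q + ∣ U ∣) + suc (m * m)          ≤⟨ +-monoˡ-≤ (suc (m * m)) (*-monoʳ-≤ 2 step) ⟩
  -- The loss `2 * m` and the extra `1` are exactly the growth from `m * m` to `suc m * suc m`.
  2 * (∣ A ∪ U ∣ + m) + suc (m * m)      ≡⟨ square ∣ A ∪ U ∣ m ⟩
  2 * ∣ A ∪ U ∣ + suc m * suc m          ∎
  where
  open ≤-Reasoning
  m = length As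
  U = ⋃ As
  split : ∀ q m → 2 * (q * suc m) + suc m ≡ 2 * q + suc (2 * (q * m) + m)
  split = solve-∀
  regroup : ∀ q u m → 2 * q + suc (2 * u + m * m) ≡ 2 * (q + u) + suc (m * m)
  regroup = solve-∀
  square : ∀ v m → 2 * (v + m) + suc (m * m) ≡ 2 * v + suc m * suc m
  square = solve-∀
  -- Inclusion-exclusion: `A` brings at least `q - m` new vertices.
  step : q + ∣ U ∣ ≤ ∣ A ∪ U ∣ + m
  step = begin
    q + ∣ U ∣                  ≡⟨ cong (_+ ∣ U ∣) ∣A∣≡q ⟨
    ∣ A ∣ + ∣ U ∣              ≡⟨ ∣p∪q∣+∣p∩q∣≡∣p∣+∣q∣ A U ⟨
    ∣ A ∪ U ∣ + ∣ A ∩ U ∣      ≤⟨ +-monoʳ-≤ ∣ A ∪ U ∣ (∣∩⋃∣≤length A As A∩) ⟩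
    ∣ A ∪ U ∣ + m              ∎

-- Upper bounds for linear hypergraphs.

-- `Unique` supplies the inequality `x ≢ y` that `Linear` asks for, which gives the pairwise form
-- suited to induction on the list.
allPairs⁺ : ∀ {a r} {A : Set a} {R : A → A → Set r} {xs : List A} → Unique xs →
  (∀ {x y} → x ∈ xs → y ∈ xs → x ≢ y → R x y) → AllPairs R xs
allPairs⁺ []             _ = []
allPairs⁺ (x∉xs ∷ unique) f =
  All.tabulate (λ y∈xs → f (here refl) (there y∈xs) (All.lookup x∉xs y∈xs)) ∷
  allPairs⁺ unique (λ x∈xs y∈xs → f (there x∈xs) (there y∈xs))

linear⇒allPairs : (H : Hypergraph q n) → Linear H →
  AllPairs (λ A B → ∣ A ∩ B ∣ ≤ 1) (edges H)
linear⇒allPairs H lin = allPairs⁺ (distinct H) lin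

linear⇒e<q : 1 ≤ n → q ≥√2· n → (H : Hypergraph q n) → Linear H → e H < q
linear⇒e<q {n} {q} 1≤n 2n≤q² H lin = ≰⇒> λ q≤e →
  -- Only `q` edges are kept: the bound `q m - m (m - 1) / 2` is largest at `m = q` and decays for
  -- many more edges.
  let As = take q (edges H)
      m≡q : length As ≡ q
      m≡q = trans (length-take q (edges H)) (m≤n⇒m⊓n≡m q≤e)
      bound : 2 * (q * q) + q ≤ 2 * ∣ ⋃ As ∣ + q * q
      bound = subst (λ m → 2 * (q * m) + m ≤ 2 * ∣ ⋃ As ∣ + m * m) m≡q
        (2qm+m≤2∣⋃∣+m² As (All.take⁺ q (uniform H)) (AllPairs.take⁺ q (linear⇒allPairs H lin)))
  in <⇒≱ (begin-strict
      2 * ∣ ⋃ As ∣ + q * q    ≤⟨ +-monoˡ-≤ (q * q) (*-monoʳ-≤ 2 (∣p∣≤n (⋃ As))) ⟩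
      2 * n + q * q           ≤⟨ +-monoˡ-≤ (q * q) 2n≤q² ⟩
      q * q + q * q           ≡⟨ m+m≡2*m (q * q) ⟩
      -- Strictness comes from the linear term of the bound, positive because `2 ≤ 2 * n ≤ q * q`.
      2 * (q * q)             <⟨ m<m+n (2 * (q * q)) 0<q ⟩
      2 * (q * q) + q         ∎) bound
  where
  open ≤-Reasoning
  0<q : 0 < q
  0<q = >-nonZero⁻¹ q {{≥√2·⇒nonZero 1≤n 2n≤q²}}

-- Since `m < q`, the quadratic term `m * m` costs at most one of the two copies of `q * m`; the
-- other survives the cancellation.
linear⇒q*e≤2n : 1 ≤ n → q ≥√2· n → (H : Hypergraph q n) → Linear H → q * e H ≤ 2 * n
linear⇒q*e≤2n {n} {q} 1≤n 2n≤q² H lin = +-cancelʳ-≤ (q * m) (q * m) (2 * n) (begin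
  q * m + q * m                  ≡⟨ m+m≡2*m (q * m) ⟩
  2 * (q * m)                    ≤⟨ m≤m+n (2 * (q * m)) m ⟩
  2 * (q * m) + m                ≤⟨ 2qm+m≤2∣⋃∣+m² (edges H) (uniform H) (linear⇒allPairs H lin) ⟩
  2 * ∣ ⋃ (edges H) ∣ + m * m    ≤⟨ +-mono-≤ (*-monoʳ-≤ 2 (∣p∣≤n (⋃ (edges H))))
                                             (*-monoˡ-≤ m (<⇒≤ (linear⇒e<q 1≤n 2n≤q² H lin))) ⟩
  2 * n + q * m                  ∎)
  where
  open ≤-Reasoning
  m = e H

-- Lower bound from maximality.

-- The edges cover at most `e H * q` vertices. If `q` more remained, a set `r` of them would be
-- disjoint from every edge and could be inserted.
maximal⇒n<q+e*q : .{{NonZero q}} → (H : Hypergraph q n) → Linear H → Maximal H →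
  n < q + e H * q
maximal⇒n<q+e*q {q} {n} H lin max = ≰⇒> λ q+eq≤n →
  let r , r⊆∁U , ∣r∣≡q = ⊆-ofSize q (∁ U) (q≤∣∁U∣ q+eq≤n)
      disjoint : ∀ {B} → B ∈ edges H → Empty (r ∩ B)
      disjoint {B} B∈H (x , x∈r∩B) =
        let x∈r , x∈B = x∈p∩q⁻ r B x∈r∩B in x∈∁p⇒x∉p (r⊆∁U x∈r) (∈⇒⊆⋃ B∈H x∈B)
      ∣r∩∣≡0 : ∀ {B} → B ∈ edges H → ∣ r ∩ B ∣ ≡ 0
      ∣r∩∣≡0 B∈H = trans (cong ∣_∣ (Empty-unique (disjoint B∈H))) (∣⊥∣≡0 n)
      r∉H : r ∉ edges H
      -- As an edge, `r` would be disjoint from itself, hence empty.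
      r∉H r∈H = q≢0 (trans (sym ∣r∣≡q) (trans (cong ∣_∣ (sym (∩-idem r))) (∣r∩∣≡0 r∈H)))
      ∣r∩∣≤1 : ∀ {B} → B ∈ edges H → ∣ r ∩ B ∣ ≤ 1
      ∣r∩∣≤1 B∈H = ≤-trans (≤-reflexive (∣r∩∣≡0 B∈H)) z≤n
      insertLinear : Linear (insert H r ∣r∣≡q r∉H)
      insertLinear = λ where
        (here refl) (here refl) r≢r → contradiction refl r≢r
        (here refl) (there B∈H) _   → ∣r∩∣≤1 B∈H
        {A} (there A∈H) (here refl) _ → subst (λ p → ∣ p ∣ ≤ 1) (∩-comm r A) (∣r∩∣≤1 A∈H)
        (there A∈H) (there B∈H) A≢B → lin A∈H B∈H A≢B
  in max (r , ∣r∣≡q , r∉H , insertLinear)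
  where
  U = ⋃ (edges H)
  q≢0 : q ≢ 0
  q≢0 = ≢-nonZero⁻¹ q
  q≤∣∁U∣ : q + e H * q ≤ n → q ≤ ∣ ∁ U ∣
  q≤∣∁U∣ q+eq≤n = begin
    q                        ≡⟨ m+n∸n≡m q ∣ U ∣ ⟨
    q + ∣ U ∣ ∸ ∣ U ∣        ≤⟨ ∸-monoˡ-≤ ∣ U ∣ (≤-trans
                                  (+-monoʳ-≤ q (∣⋃∣≤length*q (edges H) (uniform H))) q+eq≤n) ⟩
    n ∸ ∣ U ∣                ≡⟨ ∣∁p∣≡n∸∣p∣ U ⟨
    ∣ ∁ U ∣                  ∎
    where open ≤-Reasoning

maximal⇒n≤2eq : .{{NonZero q}} → (H : Hypergraph q n) → Linear H → q ≤ n → Maximal H →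
  n ≤ 2 * (e H * q)
maximal⇒n≤2eq {q} {n} H lin q≤n max = begin
  n                    ≤⟨ <⇒≤ n<q+eq ⟩
  q + e H * q          ≤⟨ +-monoˡ-≤ (e H * q) (q≤eq (e H) n<q+eq) ⟩
  e H * q + e H * q    ≡⟨ m+m≡2*m (e H * q) ⟩
  2 * (e H * q)        ∎
  where
  open ≤-Reasoning
  n<q+eq = maximal⇒n<q+e*q H lin max
  q≤eq : ∀ m → n < q + m * q → q ≤ m * q
  -- Without edges the bound reads `n < q`, against `q ≤ n`; with at least one edge, `m * q` absorbs
  -- the extra `q`.
  q≤eq zero    n<q+0 = contradiction q≤n (<⇒≱ (subst (n <_) (+-identityʳ q) n<q+0))
  q≤eq (suc m) _     = m≤m+n q (m * q)

-- Passage to rational inequalities.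

-- `ℚ./` reduces to lowest terms, so comparisons move to unnormalised fractions, where the order is
-- plain cross-multiplication.
toℚᵘ-/ : ∀ i k .{{_ : NonZero k}} → ℚ.toℚᵘ (i ℚ./ k) ℚᵘ.≃ i ℚᵘ./ k
toℚᵘ-/ i (suc k) = ℚ.toℚᵘ-fromℚᵘ (ℚᵘ.mkℚᵘ i k)

module _ (a b c d m : ℕ) .{{_ : NonZero b}} .{{_ : NonZero d}} where

  toℚᵘ-/*/ : ℚ.toℚᵘ ((+ a ℚ./ b) ℚ.* (+ c ℚ./ d)) ℚᵘ.≃ (+ a ℚᵘ./ b) ℚᵘ.* (+ c ℚᵘ./ d)
  toℚᵘ-/*/ = ℚᵘ.≃-trans (ℚ.toℚᵘ-homo-* (+ a ℚ./ b) (+ c ℚ./ d))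
    (ℚᵘ.*-cong (toℚᵘ-/ (+ a) b) (toℚᵘ-/ (+ c) d))

  /*/≤fromℕ : a * c ≤ m * (b * d) → (+ a ℚ./ b) ℚ.* (+ c ℚ./ d) ℚ.≤ fromℕ m
  /*/≤fromℕ ac≤mbd = ℚ.toℚᵘ-cancel-≤
    (ℚᵘ.≤-respˡ-≃ (ℚᵘ.≃-sym toℚᵘ-/*/)
      (ℚᵘ.≤-respʳ-≃ (ℚᵘ.≃-sym (toℚᵘ-/ (+ m) 1)) (cross b d ac≤mbd)))
    where
    -- The denominators are quantified afresh so that they can be matched as successors, which lets
    -- `ℚᵘ./` compute.
    cross : ∀ b d .{{_ : NonZero b}} .{{_ : NonZero d}} → a * c ≤ m * (b * d) →
      (+ a ℚᵘ./ b) ℚᵘ.* (+ c ℚᵘ./ d) ℚᵘ.≤ + m ℚᵘ./ 1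
    cross (suc b) (suc d) ac≤mbd = ℚᵘ.*≤* (subst₂ ℤ._≤_
      (trans (ℤ.pos-* a c) (sym (ℤ.*-identityʳ _))) (ℤ.pos-* m (suc b * suc d)) (ℤ.+≤+ ac≤mbd))

  fromℕ≤/*/ : m * (b * d) ≤ a * c → fromℕ m ℚ.≤ (+ a ℚ./ b) ℚ.* (+ c ℚ./ d)
  fromℕ≤/*/ mbd≤ac = ℚ.toℚᵘ-cancel-≤
    (ℚᵘ.≤-respʳ-≃ (ℚᵘ.≃-sym toℚᵘ-/*/)
      (ℚᵘ.≤-respˡ-≃ (ℚᵘ.≃-sym (toℚᵘ-/ (+ m) 1)) (cross b d mbd≤ac)))
    where
    cross : ∀ b d .{{_ : NonZero b}} .{{_ : NonZero d}} → m * (b * d) ≤ a * c →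
      + m ℚᵘ./ 1 ℚᵘ.≤ (+ a ℚᵘ./ b) ℚᵘ.* (+ c ℚᵘ./ d)
    cross (suc b) (suc d) mbd≤ac = ℚᵘ.*≤* (subst₂ ℤ._≤_
      (ℤ.pos-* m (suc b * suc d)) (trans (ℤ.pos-* a c) (sym (ℤ.*-identityʳ _))) (ℤ.+≤+ mbd≤ac))

proposition2 : (∀ (n q : ℕ) → 1 ≤ n → q ≥√2· n →
    (H : Hypergraph q n) → Linear H → e H < q)
    ×
    (∃[ c ] ∃[ C ] (0ℚ ℚ.< c) × (0ℚ ℚ.< C) ×
    (∀ (n q : ℕ) (1≤n : 1 ≤ n) (q≥√2n : q ≥√2· n) →
    (H : Hypergraph q n) → Linear H → q ≤ n → Maximal H →
    let instance q≢0 = ≥√2·⇒nonZero 1≤n q≥√2n in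
    (c ℚ.* (+ n ℚ./ q) ℚ.≤ fromℕ (e H)) × (fromℕ (e H) ℚ.≤ C ℚ.* (+ n ℚ./ q))))
proposition2 =
  (λ _ _ → linear⇒e<q) ,
  -- `c = 1/2` comes from `n ≤ 2 * (e H * q)` and `C = 2` from `q * e H ≤ 2 * n`.
  + 1 ℚ./ 2 , + 2 ℚ./ 1 , ℚ.positive⁻¹ (+ 1 ℚ./ 2) , ℚ.positive⁻¹ (+ 2 ℚ./ 1) ,
  λ n q 1≤n q≥√2n H lin q≤n max →
    let instance q≢0 = ≥√2·⇒nonZero 1≤n q≥√2n in
    /*/≤fromℕ 1 2 n q (e H)
      (subst₂ _≤_ (sym (*-identityˡ n)) (swap (e H) q) (maximal⇒n≤2eq H lin q≤n max)) ,
    fromℕ≤/*/ 2 1 n q (e H)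
      (subst (_≤ 2 * n) (comm (e H) q) (linear⇒q*e≤2n 1≤n q≥√2n H lin))
  where
  swap : ∀ m q → 2 * (m * q) ≡ m * (2 * q)
  swap = solve-∀
  comm : ∀ m q → q * m ≡ m * (1 * q)
  comm = solve-∀
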